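{- For every finite graph $H$, $$\mathrm{Hom}(H)\ \leq_{\mathrm P}^{\mathrm{Tur}}\ \mathrm{FulRel}(H)\ \leq_{\mathrm P}^{\mathrm{Tur}}\ \mathrm{SurHom}(H),$$ where $\leq_{\mathrm P}^{\mathrm{Tur}}$ denotes polynomial-time Turing reducibility.
   Context: Graphs are finite and undirected, with loops allowed: $G=(V_G,E_G)$ with $E_G\subseteq V_G\times V_G$ symmetric. For a graph $G$, a finite set $B$ and a relation $R\subseteq V_G\times B$ with full image (every $b\in B$ satisfies $(v,b)\in R$ for some $v$), $G\ast R$ is the graph with vertex set $B$ and edge set $\{(u,v)\in B\times B : \text{there is } (x,y)\in E_G \text{ with } (x,u),(y,v)\in R\}$. A relation from $G$ to $H$ is a relation $R\subseteq V_G\times V_H$ with full image such that $G\ast R=H$; it has full domain if every $x\in V_G$ is related to some vertex of $H$. For a fixed graph $H$, consider the following decision problems, each taking as input a finite graph $G$: - $\mathrm{Hom}(H)$: is there a homomorphism from $G$ to $H$? - $\mathrm{FulRel}(H)$: is there a relation with full domain from $G$ to $H$? - $\mathrm{SurHom}(H)$: is there a surjective homomorphism from $G$ to $H$, i.e. a homomorphism $f$ that is surjective on vertices and for which the induced map $E_G\to E_H$, $(x,y)\mapsto(f(x),f(y))$, is surjective? -}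

module Defs where

open import Data.Bool using (Bool; T)
open import Data.Fin using (Fin; zero; suc)
open import Data.Fin.Properties using (any?)
open import Data.List using (List; []; _∷_; [_]; _++_; concat; foldr; length; map; tabulate)
open import Data.Maybe using (Maybe; just; nothing)
open import Data.Nat using (ℕ; zero; suc; _+_; _*_; _≤_)
open import Data.Product using (Σ-syntax; ∃; ∃₂; ∃-syntax; _×_; _,_; proj₁)
open import Data.Vec as Vec using (Vec; _∷_)
open import Function.Bundles using (_↔_; _⇔_)
open import Function.Definitions using (StrictlySurjective)
open import Level using (0ℓ)
open import Relation.Binary.Core using (Rel; _=[_]⇒_)
open import Relation.Binary.Definitions using (Symmetric)
open import Relation.Binary.PropositionalEquality using (_≡_)
open import Relation.Nullary using (Dec; ¬_; Reflects)
open import Relation.Nullary.Decidable using (⌊_⌋; T?; _×-dec_; toWitness; fromWitness)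

record Graph : Set where
  field
    order     : ℕ
    adj       : Fin order → Fin order → Bool
    symmetric : Symmetric (λ x y → T (adj x y))

  V : Set
  V = Fin order

  E : Rel V 0ℓ
  E x y = T (adj x y)

open Graph public using (V; E)

-- Relations between finite sets are given by their characteristic functions.
Relation : Set → Set → Set
Relation A B = A → B → Bool

FullDomain : ∀ {A B} → Relation A B → Set
FullDomain R = ∀ a → ∃[ b ] T (R a b)

FullImage : ∀ {A B} → Relation A B → Set
FullImage R = ∀ b → ∃[ a ] T (R a b)

module _ (G : Graph) {b : ℕ} (R : Relation (V G) (Fin b)) where

  ImageEdge : Rel (Fin b) 0ℓ
  ImageEdge u v = ∃[ x ] ∃[ y ] E G x y × T (R x u) × T (R y v)

  imageEdge? : ∀ u v → Dec (ImageEdge u v)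
  imageEdge? u v =
    any? λ x → any? λ y → T? (Graph.adj G x y) ×-dec T? (R x u) ×-dec T? (R y v)

  _∗_ : Graph
  _∗_ = record
    { order     = b
    ; adj       = λ u v → ⌊ imageEdge? u v ⌋
    ; symmetric = λ {u} {v} uv →
        let (x , y , xy , xu , yv) = toWitness {a? = imageEdge? u v} uv
        in fromWitness {a? = imageEdge? v u} (y , x , Graph.symmetric G xy , yv , xu)
    }

-- Since G ∗ R has the same vertex set as H, the equation G ∗ R = H says that
-- the two edge sets have the same elements.
IsRelationFromTo : (G H : Graph) → Relation (V G) (V H) → Set
IsRelationFromTo G H R = FullImage R × (∀ u v → E (G ∗ R) u v ⇔ E H u v)

IsHomomorphism : (G H : Graph) → (V G → V H) → Set
IsHomomorphism G H f = E G =[ f ]⇒ E H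

IsSurjectiveHomomorphism : (G H : Graph) → (V G → V H) → Set
IsSurjectiveHomomorphism G H f =
  IsHomomorphism G H f ×
  StrictlySurjective _≡_ f ×
  (∀ {u v} → E H u v → ∃₂ λ x y → E G x y × f x ≡ u × f y ≡ v)

Problem : Set₁
Problem = Graph → Set

Hom : Graph → Problem
Hom H G = ∃[ f ] IsHomomorphism G H f

FulRel : Graph → Problem
FulRel H G = ∃[ R ] IsRelationFromTo G H R × FullDomain R

SurHom : Graph → Problem
SurHom H G = ∃[ f ] IsSurjectiveHomomorphism G H f

-- Graphs as words: the rows of the adjacency matrix, each followed by an
-- end marker, so that a graph with n vertices has a code of length n (n + 1).
data Symbol : Set where
  bit : Bool → Symbol
  end : Symbol

Word : Set
Word = List Symbol

encode : Graph → Word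
encode G = concat (tabulate λ x → tabulate (λ y → bit (adj x y)) ++ [ end ])
  where open Graph G

-- The set of codes of yes-instances; a word that codes no graph is not in it.
Language : Problem → Word → Set
Language P w = ∃[ G ] encode G ≡ w × P G

-- `nothing` is the blank.
Cell : Set
Cell = Maybe Symbol

-- A two-way infinite tape: the cell under the head, and the cells to its left
-- and right, nearest first.  Cells beyond the ends of the lists are blank.
record Tape : Set where
  constructor tape
  field
    left  : List Cell
    head  : Cell
    right : List Cell

data Direction : Set where
  leftwards stay rightwards : Direction

Action : Set
Action = Cell × Direction

move : Direction → Tape → Tape
move leftwards  (tape []       h rs)       = tape [] nothing (h ∷ rs)
move leftwards  (tape (l ∷ ls) h rs)       = tape ls l (h ∷ rs)
move stay       t                          = t
move rightwards (tape ls       h [])       = tape (h ∷ ls) nothing []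
move rightwards (tape ls       h (r ∷ rs)) = tape (h ∷ ls) r rs

act : Action → Tape → Tape
act (c , d) (tape ls _ rs) = move d (tape ls c rs)

blankTape : Tape
blankTape = tape [] nothing []

-- The head is on the first symbol of the word.
writeWord : Word → Tape
writeWord []      = blankTape
writeWord (a ∷ w) = tape [] (just a) (map just w)

upToBlank : List Cell → Word
upToBlank (just a ∷ cs) = a ∷ upToBlank cs
upToBlank _             = []

-- The word starting at the head and extending rightwards up to the first blank.
readWord : Tape → Word
readWord (tape _ h rs) = upToBlank (h ∷ rs)

-- What a machine does in a given state: halt with a verdict; ask the oracle
-- and continue in one of two states; or apply a transition function, which
-- sees the cells under the heads.
data Instruction (State : Set) (tapes : ℕ) : Set where
  halt : (verdict : Bool) → Instruction State tapes
  ask  : (ifYes ifNo : State) → Instruction State tapes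
  step : (Vec Cell tapes → State × Vec Action tapes) → Instruction State tapes

-- A deterministic multitape oracle Turing machine; the first tape carries the
-- input, the second is the query tape.
record OracleMachine : Set₁ where
  field
    State       : Set
    size        : ℕ
    finite      : State ↔ Fin size
    workTapes   : ℕ
    start       : State

  tapes : ℕ
  tapes = 2 + workTapes

  field
    instruction : State → Instruction State tapes

module Execution (M : OracleMachine) (Oracle : Word → Set) where
  open OracleMachine M

  Config : Set
  Config = State × Vec Tape tapes

  initial : Word → Config
  initial w = start , writeWord w ∷ Vec.replicate (suc workTapes) blankTape

  query : Vec Tape tapes → Word
  query ts = readWord (Vec.lookup ts (suc zero))

  data _⟶_ : Config → Config → Set where
    stepped : ∀ {q ts δ} → instruction q ≡ step δ →
              let (q′ , as) = δ (Vec.map Tape.head ts) in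
              (q , ts) ⟶ (q′ , Vec.zipWith act as ts)
    yes     : ∀ {q ts q₁ q₀} → instruction q ≡ ask q₁ q₀ →
              Oracle (query ts) → (q , ts) ⟶ (q₁ , ts)
    no      : ∀ {q ts q₁ q₀} → instruction q ≡ ask q₁ q₀ →
              ¬ Oracle (query ts) → (q , ts) ⟶ (q₀ , ts)

  data _⟶[_]_ : Config → ℕ → Config → Set where
    done   : ∀ {c} → c ⟶[ 0 ] c
    _then_ : ∀ {c c′ c″ n} → c ⟶ c′ → c′ ⟶[ n ] c″ → c ⟶[ suc n ] c″

  HaltsWith : Word → ℕ → Bool → Set
  HaltsWith w n b = ∃[ c ] initial w ⟶[ n ] c × instruction (proj₁ c) ≡ halt b

-- Coefficients, constant term first.
Polynomial : Set
Polynomial = List ℕ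

eval : Polynomial → ℕ → ℕ
eval p n = foldr (λ a r → a + n * r) 0 p

DecidesInTime : OracleMachine → Problem → Polynomial → Problem → Set
DecidesInTime M Q p P =
  ∀ G → ∃₂ λ n b →
    n ≤ eval p (length (encode G)) × HaltsWith (encode G) n b × Reflects (P G) b
  where open Execution M (Language Q)

infix 4 _≤ᵀ_

_≤ᵀ_ : Problem → Problem → Set₁
P ≤ᵀ Q = Σ[ M ∈ OracleMachine ] Σ[ p ∈ Polynomial ] DecidesInTime M Q p P

{-# OPTIONS --safe #-}

-- Both reductions are many-one.  There is a homomorphism f : G → H iff there is
-- a relation with full domain from the disjoint union H ⊕ G to H: the graph of
-- [id , f] is one, and conversely any choice of related vertices is a
-- homomorphism.  There is a relation with full domain from G to H iff there is
-- a surjective homomorphism to H from the graph in which every vertex of G is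
-- replaced by enough (here 1 + |H|) twins: the twins of x are mapped onto the
-- set of vertices related to x.
--
-- The adjacency matrices are written row by row on the query tape.  No work tape
-- is needed: a row of G is read several times by rewinding the input head to its
-- beginning, and every repetition that depends only on H is unrolled.
module Submission where

open import Data.Bool using (Bool; true; false; T; if_then_else_)
open import Data.Fin using (Fin; zero; suc; _↑ˡ_; _↑ʳ_; splitAt; combine; remainder; quotient; finToFun; funToFin)
open import Data.Fin.Properties using (_≟_; all?; any?; 1↔⊤; +↔⊎; splitAt-↑ˡ; splitAt-↑ʳ; remQuot-combine; combine-remQuot; finToFun-funToFin)
open import Data.List using (List; allFin; []; _∷_; [_]; _++_; concat; concatMap; length; map; replicate; reverse; tabulate; _ʳ++_)
open import Data.List.Properties
open import Data.List.Relation.Unary.All as All using (All; []; _∷_; universal)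
import Data.List.Relation.Unary.All.Properties as All
open import Data.Maybe using (just; nothing)
open import Data.Nat using (ℕ; zero; suc; _+_; _*_; _≤_; z≤n; s≤s)
open import Data.Nat.Properties using (≤-refl; ≤-reflexive; ≤-trans; +-mono-≤; +-monoʳ-≤; *-mono-≤; m≤m*n; +-assoc; +-comm; module ≤-Reasoning)
open import Data.Nat.Tactic.RingSolver using (solve-∀)
open import Data.Product using (∃; ∃-syntax; _×_; _,_; proj₁; proj₂)
open import Data.Sum using (_⊎_; inj₁; inj₂; [_,_]′)
open import Data.Sum.Function.Propositional using (_⊎-↔_)
open import Data.Sum.Properties using ([,]-map)
open import Data.Unit using (⊤; tt)
open import Data.Vec as Vec using (Vec; []; _∷_)
open import Function using (_∘_; id; const)
open import Function.Bundles using (_↔_; _⇔_; mk⇔; Equivalence)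
open import Function.Properties.Inverse using (↔-sym; ↔-trans; ↔-refl)
open import Relation.Binary.Definitions using (Symmetric)
open import Relation.Binary.PropositionalEquality using (_≡_; refl; sym; trans; cong; cong₂; subst; subst₂; module ≡-Reasoning)
open import Relation.Nullary using (Dec; yes; no; does; proof; Reflects; ofʸ; ofⁿ)
open import Relation.Nullary.Decidable using (⌊_⌋; map′; _×-dec_; _→-dec_; T?; toWitness; fromWitness)
open import Defs

-- Structured programs on two tapes and their running times

infixr 5 _⨟_

data Program : Set where
  perform : (Vec Cell 2 → Vec Action 2) → Program
  _⨟_     : Program → Program → Program
  while   : (Vec Cell 2 → Bool) → Program → Program

Tapes : Set
Tapes = Vec Tape 2

heads : Tapes → Vec Cell 2
heads = Vec.map Tape.head

infix 4 _⊢_⇓⟨_⟩_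

-- The number is an upper bound for the running time.
data _⊢_⇓⟨_⟩_ : Program → Tapes → ℕ → Tapes → Set where
  performed : ∀ {f s} → perform f ⊢ s ⇓⟨ 1 ⟩ Vec.zipWith act (f (heads s)) s
  _then_    : ∀ {c d s s′ s″ m n} → c ⊢ s ⇓⟨ m ⟩ s′ → d ⊢ s′ ⇓⟨ n ⟩ s″ →
              c ⨟ d ⊢ s ⇓⟨ m + n ⟩ s″
  exit      : ∀ {b c s} → b (heads s) ≡ false → while b c ⊢ s ⇓⟨ 1 ⟩ s
  iterate   : ∀ {b c s s′ s″ m n} → b (heads s) ≡ true →
              c ⊢ s ⇓⟨ m ⟩ s′ → while b c ⊢ s′ ⇓⟨ n ⟩ s″ →
              while b c ⊢ s ⇓⟨ suc (m + n) ⟩ s″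
  within    : ∀ {c s s′ m n} → m ≤ n → c ⊢ s ⇓⟨ m ⟩ s′ → c ⊢ s ⇓⟨ n ⟩ s′

-- Compilation to oracle machines

Label : Program → Set
Label (perform _) = ⊤
Label (c ⨟ d)     = Label c ⊎ Label d
Label (while _ c) = ⊤ ⊎ Label c

∣_∣ : Program → ℕ
∣ perform _ ∣ = 1
∣ c ⨟ d ∣     = ∣ c ∣ + ∣ d ∣
∣ while _ c ∣ = 1 + ∣ c ∣

labels : ∀ c → Label c ↔ Fin ∣ c ∣
labels (perform _) = ↔-sym 1↔⊤
labels (c ⨟ d)     = ↔-trans (labels c ⊎-↔ labels d) (↔-sym +↔⊎)
labels (while _ c) = ↔-trans (↔-sym 1↔⊤ ⊎-↔ labels c) (↔-sym +↔⊎)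

entry : ∀ c → Label c
entry (perform _) = tt
entry (c ⨟ d)     = inj₁ (entry c)
entry (while _ c) = inj₁ tt

-- The code of a program whose labels are embedded among the states by the
-- first argument and which is followed by the state `next`.
code : ∀ {S : Set} c → (Label c → S) → S → Label c → Instruction S 2
code (perform f) at next _        = step λ cs → next , f cs
code (c ⨟ d)     at next (inj₁ l) = code c (at ∘ inj₁) (at (inj₂ (entry d))) l
code (c ⨟ d)     at next (inj₂ l) = code d (at ∘ inj₂) next l
code (while b c) at next (inj₁ _) =
  -- A test takes a machine step of its own, so it writes back the cells that it reads and moves no
  -- head.
  step λ cs → (if b cs then at (inj₂ (entry c)) else next) , Vec.map (_, stay) cs
code (while b c) at next (inj₂ l) = code c (at ∘ inj₂) (at (inj₁ tt)) l

queryMachine : Program → OracleMachine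
queryMachine c = record
  { State       = Label c ⊎ Fin 3
  ; size        = ∣ c ∣ + 3
  ; finite      = ↔-trans (labels c ⊎-↔ ↔-refl) (↔-sym +↔⊎)
  ; workTapes   = 0
  ; start       = inj₁ (entry c)
  ; instruction = [ code c inj₁ (inj₂ zero) , finish ]′
  }
  where
  finish : Fin 3 → Instruction (Label c ⊎ Fin 3) 2
  finish zero             = ask (inj₂ (suc zero)) (inj₂ (suc (suc zero)))
  finish (suc zero)       = halt true
  finish (suc (suc zero)) = halt false

module _ (main : Program) (Oracle : Word → Set) where
  open OracleMachine (queryMachine main) using (State; instruction)
  open Execution (queryMachine main) Oracle 
    using (_⟶_; stepped; _⟶[_]_; done; _then_; HaltsWith)
    renaming (yes to answered-yes; no to answered-no)

  private
    append : ∀ {c c′ c″ m n} → c ⟶[ m ] c′ → c′ ⟶[ n ] c″ → c ⟶[ m + n ] c″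
    append done       ys = ys
    append (x then xs) ys = x then append xs ys

    stayed : ∀ s → Vec.zipWith act (Vec.map (_, stay) (heads s)) s ≡ s
    stayed (_ ∷ _ ∷ []) = refl

    tested : ∀ {q q₁ q₀ s v} (b : Vec Cell 2 → Bool) →
             instruction q ≡ step (λ cs → (if b cs then q₁ else q₀) , Vec.map (_, stay) cs) →
             b (heads s) ≡ v → (q , s) ⟶ ((if v then q₁ else q₀) , s)
    tested {q} {q₁} {q₀} {s} b q≡ refl =
      subst (λ s′ → (q , s) ⟶ ((if b (heads s) then q₁ else q₀) , s′)) (stayed s) (stepped q≡)

  -- Induction on the run. The embedding `at` and the continuation `next` are arbitrary because
  -- subprograms run inside larger ones; the true time `m` can be smaller than `n` on account of
  -- `within`.
  execute : ∀ {c s s′ n} (at : Label c → State) (next : State) →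
            (∀ l → instruction (at l) ≡ code c at next l) →
            c ⊢ s ⇓⟨ n ⟩ s′ →
            ∃[ m ] m ≤ n × (at (entry c) , s) ⟶[ m ] (next , s′)
  execute at next at≡ performed = 1 , ≤-refl , stepped (at≡ tt) then done
  execute {c = c ⨟ d} at next at≡ (r then r′) =
    let (m , m≤ , p) = execute (at ∘ inj₁) (at (inj₂ (entry d))) (at≡ ∘ inj₁) r
        (n , n≤ , q) = execute (at ∘ inj₂) next (at≡ ∘ inj₂) r′
    in m + n , +-mono-≤ m≤ n≤ , append p q
  execute {c = while b c} at next at≡ (exit stop) =
    1 , ≤-refl , tested b (at≡ (inj₁ tt)) stop then done
  execute {c = while b c} at next at≡ (iterate go r r′) =
    let (m , m≤ , p) = execute (at ∘ inj₂) (at (inj₁ tt)) (at≡ ∘ inj₂) r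
        (n , n≤ , q) = execute at next at≡ r′
    in suc (m + n) , s≤s (+-mono-≤ m≤ n≤) ,
       tested b (at≡ (inj₁ tt)) go then append p q
  execute at next at≡ (within m≤n r) =
    let (m , m≤ , p) = execute at next at≡ r in m , ≤-trans m≤ m≤n , p

  -- The `+ 1` pays for the question. The oracle is an arbitrary predicate, so the transition taken
  -- is selected by the `Reflects` hypothesis.
  answer : ∀ {w s n v} → main ⊢ writeWord w ∷ blankTape ∷ [] ⇓⟨ n ⟩ s →
           Reflects (Oracle (readWord (Vec.lookup s (suc zero)))) v →
           ∃[ m ] m ≤ n + 1 × HaltsWith w m v
  answer r oracle with execute inj₁ (inj₂ zero) (λ _ → refl) r | oracle
  ... | m , m≤n , p | ofʸ q = m + 1 , +-mono-≤ m≤n ≤-refl , _ , append p (answered-yes refl q then done) , refl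
  ... | m , m≤n , p | ofⁿ q = m + 1 , +-mono-≤ m≤n ≤-refl , _ , append p (answered-no refl q then done) , refl

-- Programs that read the input and append to the query tape

-- Keeps the cell under the head in one list with the cells to its right, so that the end of the
-- input needs no separate treatment.
at : List Cell → List Cell → Tape
at ls []       = tape ls nothing []
at ls (c ∷ cs) = tape ls c cs

infix 4 _⊢_⟿⟨_⟩_⊣_

-- The program takes the first input tape to the second one and appends the
-- word to the query tape.
record _⊢_⟿⟨_⟩_⊣_ (c : Program) (t : Tape) (n : ℕ) (t′ : Tape) (w : Word) : Set where
  field
    run : ∀ os → c ⊢ t ∷ at os [] ∷ [] ⇓⟨ n ⟩ t′ ∷ at (map just w ʳ++ os) [] ∷ []

open _⊢_⟿⟨_⟩_⊣_

retime : ∀ {c p q w m n} → m ≤ n → c ⊢ p ⟿⟨ m ⟩ q ⊣ w → c ⊢ p ⟿⟨ n ⟩ q ⊣ w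
retime m≤n r .run os = within m≤n (r .run os)

reword : ∀ {c p q v w n} → v ≡ w → c ⊢ p ⟿⟨ n ⟩ q ⊣ v → c ⊢ p ⟿⟨ n ⟩ q ⊣ w
reword refl r = r

-- The left part of a tape is listed nearest cell first, so output accumulates by `ʳ++`; this merges
-- two consecutive outputs.
append-++ : ∀ v w (os : List Cell) →
            map just w ʳ++ map just v ʳ++ os ≡ map just (v ++ w) ʳ++ os
append-++ v w os = sym (trans (cong (_ʳ++ os) (map-++ just v w)) (++-ʳ++ (map just v)))

infixr 5 _⨟ʷ_

_⨟ʷ_ : ∀ {c d p q r m n v w} → c ⊢ p ⟿⟨ m ⟩ q ⊣ v → d ⊢ q ⟿⟨ n ⟩ r ⊣ w →
       c ⨟ d ⊢ p ⟿⟨ m + n ⟩ r ⊣ v ++ w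
_⨟ʷ_ {c} {d} {p} {r = r} {m} {n} {v} {w} x y .run os =
  subst (λ os′ → c ⨟ d ⊢ p ∷ at os [] ∷ [] ⇓⟨ m + n ⟩ r ∷ at os′ [] ∷ [])
        (append-++ v w os)
        (x .run os then y .run (map just v ʳ++ os))

skip : Program
skip = perform (Vec.map (_, stay))

skip-appends : ∀ {p} → skip ⊢ p ⟿⟨ 1 ⟩ p ⊣ []
skip-appends .run os = performed

emit : (Cell → Cell) → Program
emit f = perform λ { (i ∷ _ ∷ []) → (i , stay) ∷ (f i , rightwards) ∷ [] }

emit-appends : ∀ {f a t} → f (Tape.head t) ≡ just a → emit f ⊢ t ⟿⟨ 1 ⟩ t ⊣ [ a ]
emit-appends {f} {t = t} eq .run os =
  subst (λ x → emit f ⊢ t ∷ at os [] ∷ [] ⇓⟨ 1 ⟩ t ∷ at (x ∷ os) [] ∷ []) eq performed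

write : Symbol → Program
write a = emit (const (just a))

write-appends : ∀ {p} a → write a ⊢ p ⟿⟨ 1 ⟩ p ⊣ [ a ]
write-appends a .run os = performed

copy : Program
copy = emit id

shift : Fin 2 → Direction → Program
shift k d = perform λ cs →
  Vec.tabulate λ j → Vec.lookup cs j , (if does (j ≟ k) then d else stay)

advance : Program
advance = shift zero rightwards

move-rightwards : ∀ ls c cs → move rightwards (tape ls c cs) ≡ at (c ∷ ls) cs
move-rightwards ls c []      = refl
move-rightwards ls c (_ ∷ _) = refl

advance-appends : ∀ {ls c cs} → advance ⊢ tape ls c cs ⟿⟨ 1 ⟩ at (c ∷ ls) cs ⊣ []
advance-appends {ls} {c} {cs} .run os =
  subst (λ t → advance ⊢ tape ls c cs ∷ at os [] ∷ [] ⇓⟨ 1 ⟩ t ∷ at os [] ∷ [])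
        (move-rightwards ls c cs) performed

-- A loop unrolled into the program itself, so that no counter has to be kept on a tape.
each : ∀ {A : Set} → List A → (A → Program) → Program
each []       f = skip
each (x ∷ xs) f = f x ⨟ each xs f

-- Every body restores the input tape `p`, ready for the next one. The last `+ 1` is the closing
-- `skip`.
each-appends : ∀ {A : Set} {f : A → Program} {g : A → Word} {p m} (xs : List A) →
               (∀ x → f x ⊢ p ⟿⟨ m ⟩ p ⊣ g x) →
               each xs f ⊢ p ⟿⟨ length xs * m + 1 ⟩ p ⊣ concatMap g xs
each-appends []       body = skip-appends
each-appends {m = m} (x ∷ xs) body =
  retime (≤-reflexive (sym (+-assoc m (length xs * m) 1))) (body x ⨟ʷ each-appends xs body)

writeAll : Word → Program
writeAll w = each w write

writeAll-appends : ∀ {p} w → writeAll w ⊢ p ⟿⟨ length w * 1 + 1 ⟩ p ⊣ w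
writeAll-appends w = reword (concat-map-[ w ]) (each-appends w write-appends)

repeat : ℕ → Program → Program
repeat k c = each (replicate k tt) (const c)

repeat-appends : ∀ {c p m w} k → c ⊢ p ⟿⟨ m ⟩ p ⊣ w →
                 repeat k c ⊢ p ⟿⟨ k * m + 1 ⟩ p ⊣ concat (replicate k w)
repeat-appends {m = m} {w} k body =
  retime (≤-reflexive (cong (λ l → l * m + 1) (length-replicate k)))
    (reword (cong concat (map-replicate (const w) k tt))
      (each-appends (replicate k tt) (const body)))

-- Loops on one tape and rewinding

whileOn : Fin 2 → (Cell → Bool) → Program → Program
whileOn k p = while λ cs → p (Vec.lookup cs k)

-- The head ends on the leftmost cell of the maximal block of cells satisfying
-- p to the left of its initial position.
rewind : Fin 2 → (Cell → Bool) → Program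
rewind k p = shift k leftwards ⨟ whileOn k p (shift k leftwards) ⨟ shift k rightwards

-- Allows rewinding to be verified once for the input tape and the query tape alike.
focus : Fin 2 → Tape → Tape → Tapes
focus zero    s t = t ∷ s ∷ []
focus (suc _) s t = s ∷ t ∷ []

shift-runs : ∀ k d s t → shift k d ⊢ focus k s t ⇓⟨ 1 ⟩ focus k s (move d t)
shift-runs zero       d s t = performed
shift-runs (suc zero) d s t = performed

All-ʳ++ : ∀ {A : Set} {P : A → Set} {xs ys} → All P xs → All P ys → All P (xs ʳ++ ys)
All-ʳ++ []         pys = pys
All-ʳ++ (px ∷ pxs) pys = All-ʳ++ pxs (px ∷ pys)

module _ (k : Fin 2) (p : Cell → Bool) {s : Tape} {x c : Cell} {ls cs : List Cell} (px : p x ≡ false) where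

  private
    reads : ∀ k {v} t → p (Tape.head t) ≡ v → p (Vec.lookup (heads (focus k s t)) k) ≡ v
    reads zero       t eq = eq
    reads (suc zero) t eq = eq

    -- The situation after the first move to the left: `bs` lists the cells still to be passed,
    -- nearest first, and `x` stops the loop. Each cell of `bs` costs a test and a move.
    walk : ∀ {c cs} bs → All (λ b → p b ≡ true) bs →
           whileOn k p (shift k leftwards) ⊢
             focus k s (move leftwards (tape (bs ++ x ∷ ls) c cs)) ⇓⟨ length bs * 2 + 1 ⟩
             focus k s (tape ls x (bs ʳ++ c ∷ cs))
    walk {c} {cs} [] [] = exit (reads k (tape ls x (c ∷ cs)) px)
    walk {c} {cs} (b ∷ bs) (pb ∷ pbs) =
      iterate (reads k (tape (bs ++ x ∷ ls) b (c ∷ cs)) pb) (shift-runs k leftwards s _) (walk bs pbs)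

  -- The extra 3 steps are the first move to the left, the failing test on `x` and the move back off
  -- `x`.
  rewind-runs : ∀ bs → All (λ b → p b ≡ true) bs →
                rewind k p ⊢ focus k s (tape (bs ʳ++ x ∷ ls) c cs) ⇓⟨ length bs * 2 + 3 ⟩
                             focus k s (at (x ∷ ls) (bs ++ c ∷ cs))
  rewind-runs bs pbs =
    within (≤-reflexive (trans (cong (λ n → 1 + (n * 2 + 1 + 1)) (length-reverse bs)) (time (length bs))))
      -- `walk` meets the block from right to left, so it is applied to `reverse bs`; its reverse
      -- append restores the reading order.
      (subst₂ (λ before after → rewind k p ⊢ focus k s (tape before c cs) ⇓⟨ _ ⟩ focus k s after)
        (sym (ʳ++-defn bs))
        (trans (move-rightwards ls x (reverse bs ʳ++ c ∷ cs))
               (cong (at (x ∷ ls)) (ʳ++-ʳ++ bs)))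
        (shift-runs k leftwards s _ then
          (walk (reverse bs) (All-ʳ++ pbs []) then shift-runs k rightwards s _)))
    where
    time : ∀ n → 1 + (n * 2 + 1 + 1) ≡ n * 2 + 3
    time = solve-∀

isBit : Cell → Bool
isBit (just (bit _)) = true
isBit _              = false

nonBlank : Cell → Bool
nonBlank (just _) = true
nonBlank nothing  = false

bits : List Bool → List Cell
bits = map (just ∘ bit)

-- In use, `x` is the end marker of the previous row or, before the first row, a blank.
rewind-bits : ∀ {x ls c cs} r → isBit x ≡ false →
              rewind zero isBit ⊢ tape (bits r ʳ++ x ∷ ls) c cs ⟿⟨ length r * 2 + 3 ⟩
                                  at (x ∷ ls) (bits r ++ c ∷ cs) ⊣ []
rewind-bits r x-end .run os =
  within (≤-reflexive (cong (λ n → n * 2 + 3) (length-map (just ∘ bit) r)))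
    (rewind-runs zero isBit x-end (bits r) (All.map⁺ (universal (λ _ → refl) r)))

while-exits : ∀ p {c t} → p (Tape.head t) ≡ false → whileOn zero p c ⊢ t ⟿⟨ 1 ⟩ t ⊣ []
while-exits p stop .run os = exit stop

while-iterates : ∀ p {c t t′ t″ m n v w} → p (Tape.head t) ≡ true →
                 c ⊢ t ⟿⟨ m ⟩ t′ ⊣ v → whileOn zero p c ⊢ t′ ⟿⟨ n ⟩ t″ ⊣ w →
                 whileOn zero p c ⊢ t ⟿⟨ suc (m + n) ⟩ t″ ⊣ v ++ w
while-iterates p {c} {t} {t″ = t″} {m} {n} {v} {w} go x y .run os =
  subst (λ os′ → whileOn zero p c ⊢ t ∷ at os [] ∷ [] ⇓⟨ suc (m + n) ⟩ t″ ∷ at os′ [] ∷ [])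
        (append-++ v w os)
        (iterate go (x .run os) (y .run (map just v ʳ++ os)))

overBits : Program → Program
overBits = whileOn zero isBit

-- The body passes exactly one bit; `suc m` adds the test to it, and the last `+ 1` is the failing
-- test on `x`.
overBits-appends : ∀ {c m x cs} {g : Bool → Word} →
  (∀ {ls cs} b → c ⊢ tape ls (just (bit b)) cs ⟿⟨ m ⟩ at (just (bit b) ∷ ls) cs ⊣ g b) →
  isBit x ≡ false → ∀ {ls} r →
  overBits c ⊢ at ls (bits r ++ x ∷ cs) ⟿⟨ length r * suc m + 1 ⟩
               tape (bits r ʳ++ ls) x cs ⊣ concatMap g r
overBits-appends body x-end []      = while-exits isBit x-end
overBits-appends {m = m} body x-end (b ∷ r) =
  retime (≤-reflexive (cong suc (sym (+-assoc m (length r * suc m) 1))))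
    (while-iterates isBit refl (body b) (overBits-appends body x-end r))

-- Codes of lists of rows

row : List Bool → Word
row r = map bit r ++ [ end ]

word : List (List Bool) → Word
word = concatMap row

cells-row : ∀ r w → map just (row r ++ w) ≡ bits r ++ just end ∷ map just w
cells-row []      w = refl
cells-row (b ∷ r) w = cong (just (bit b) ∷_) (cells-row r w)

overRows : Program → Program
overRows = whileOn zero nonBlank

-- The common length `n` gives all rows the same time bound. A non-bit `x` is kept to the left of
-- each row so that the body can rewind to the row's beginning.
overRows-appends : ∀ {c m n} {g : List Bool → Word} →
  (∀ {x ls cs} r → length r ≡ n → isBit x ≡ false →
    c ⊢ at (x ∷ ls) (bits r ++ just end ∷ cs) ⟿⟨ m ⟩
        at (just end ∷ (bits r ʳ++ x ∷ ls)) cs ⊣ g r) →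
  ∀ {x ls} rs → All (λ r → length r ≡ n) rs → isBit x ≡ false →
  ∃[ t ] overRows c ⊢ at (x ∷ ls) (map just (word rs)) ⟿⟨ length rs * suc m + 1 ⟩
                      t ⊣ concatMap g rs
overRows-appends body [] [] x-end = _ , while-exits nonBlank refl
overRows-appends {c} {m} {g = g} body {x} {ls} (r ∷ rs) (len ∷ lens) x-end =
  -- For the next row, the end marker just passed is the non-bit on the left.
  let (t , rest) = overRows-appends body rs lens refl
  in t , retime (≤-reflexive (cong suc (sym (+-assoc m (length rs * suc m) 1))))
    (subst (λ cs → overRows c ⊢ at (x ∷ ls) cs ⟿⟨ suc (m + (length rs * suc m + 1)) ⟩ t ⊣ g r ++ concatMap g rs)
      (sym (cells-row r (word rs)))
      (while-iterates nonBlank (nonBlank-row r) (body r len x-end) rest))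
  where
  nonBlank-row : ∀ {ls cs} r → nonBlank (Tape.head (at ls (bits r ++ just end ∷ cs))) ≡ true
  nonBlank-row []      = refl
  nonBlank-row (_ ∷ _) = refl

-- Makes the cells to the left of the heads explicit, so that rewinding
-- restores a tape exactly.
centre : Program
centre = perform (Vec.map (_, leftwards)) ⨟ perform (Vec.map (_, rightwards))

centre-runs : ∀ w → centre ⊢ writeWord w ∷ blankTape ∷ [] ⇓⟨ 2 ⟩
                              at [ nothing ] (map just w) ∷ at [ nothing ] [] ∷ []
centre-runs []      = performed then performed
centre-runs (_ ∷ _) = performed then performed

transduce : Program → Program
transduce c = centre ⨟ c ⨟ rewind (suc zero) nonBlank

-- The closing rewind is stopped by the blank that `centre` made explicit, and so puts the query
-- head on the first output symbol, where `readWord` begins.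
transduce-runs : ∀ {c n t v} w → c ⊢ at [ nothing ] (map just w) ⟿⟨ n ⟩ t ⊣ v →
  ∃[ s ] transduce c ⊢ writeWord w ∷ blankTape ∷ [] ⇓⟨ 2 + (n + (length v * 2 + 3)) ⟩ s ×
         readWord (Vec.lookup s (suc zero)) ≡ v
transduce-runs {v = v} w r =
  _ , (centre-runs w then (r .run [ nothing ] then
        within (≤-reflexive (cong (λ n → n * 2 + 3) (length-map just v)))
          (rewind-runs (suc zero) nonBlank refl (map just v) (All.map⁺ (universal (λ _ → refl) v)))))
    , reads v
  where
  -- The trailing blank is the cell on which the query head stood after the output.
  upToBlank-word : ∀ v → upToBlank (map just v ++ [ nothing ]) ≡ v
  upToBlank-word []      = refl
  upToBlank-word (a ∷ v) = cong (a ∷_) (upToBlank-word v)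
  reads : ∀ v → readWord (at [ nothing ] (map just v ++ [ nothing ])) ≡ v
  reads []      = refl
  reads (a ∷ v) = cong (a ∷_) (upToBlank-word v)

concatMap-[_∘_] : ∀ {A B : Set} (f : A → B) xs → concatMap ([_] ∘ f) xs ≡ map f xs
concatMap-[ f ∘ xs ] = trans (cong concat (map-∘ xs)) concat-map-[ map f xs ]

concat-replicate-[_] : ∀ {A : Set} (x : A) k → concat (replicate k [ x ]) ≡ replicate k x
concat-replicate-[ x ] k = trans (cong concat (sym (map-replicate [_] k x))) concat-map-[ replicate k x ]

-- Programs for single rows

-- Left unsimplified so as to agree definitionally with the times of the composed programs.
padTime headerTime stretchTime : ℕ → ℕ → ℕ
padTime h n     = (h * 1 + 1) + ((n * 3 + 1) + 2)
headerTime h n  = (h * 1 + 1) + ((n * 3 + 1) + (1 + (n * 2 + 3)))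
stretchTime k n = (k * ((n * suc (k * 1 + 1 + 1) + 1) + (1 + (n * 2 + 3))) + 1) + ((n * 2 + 1) + 1)

-- Used for the rows of `G` in the disjoint union, with zeros `z` in the columns of `H`. The last
-- `copy` takes the end marker.
padLeft : List Bool → Program
padLeft z = writeAll (map bit z) ⨟ overBits (copy ⨟ advance) ⨟ copy ⨟ advance

padLeft-appends : ∀ z {x ls cs} r → isBit x ≡ false →
  padLeft z ⊢ at (x ∷ ls) (bits r ++ just end ∷ cs)
            ⟿⟨ padTime (length z) (length r) ⟩
              at (just end ∷ (bits r ʳ++ x ∷ ls)) cs ⊣ row (z ++ r)
padLeft-appends z r x-end =
  retime (≤-reflexive (cong (λ l → padTime l (length r)) (length-map bit z)))
    (reword (begin
        map bit z ++ concatMap ([_] ∘ bit) r ++ [ end ]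
      ≡⟨ cong (λ w → map bit z ++ w ++ [ end ]) concatMap-[ bit ∘ r ] ⟩
        map bit z ++ map bit r ++ [ end ]
      ≡⟨ ++-assoc (map bit z) (map bit r) [ end ] ⟨
        (map bit z ++ map bit r) ++ [ end ]
      ≡⟨ cong (_++ [ end ]) (map-++ bit z r) ⟨
        row (z ++ r) ∎)
      (writeAll-appends (map bit z) ⨟ʷ
       overBits-appends (λ b → emit-appends refl ⨟ʷ advance-appends) refl r ⨟ʷ
       emit-appends refl ⨟ʷ advance-appends))
  where open ≡-Reasoning

-- Used for the rows `z` of `H` in the disjoint union. The row of `G` under the head only measures
-- how many zeros follow, and is rewound for the next use.
padRight : List Bool → Program
padRight z = writeAll (map bit z) ⨟ overBits (write (bit false) ⨟ advance) ⨟ write end ⨟ rewind zero isBit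

padRight-appends : ∀ z {x y ls cs} r → isBit x ≡ false → isBit y ≡ false →
  padRight z ⊢ at (x ∷ ls) (bits r ++ y ∷ cs)
             ⟿⟨ headerTime (length z) (length r) ⟩
               at (x ∷ ls) (bits r ++ y ∷ cs) ⊣ row (z ++ replicate (length r) false)
padRight-appends z r x-end y-end =
  retime (≤-reflexive (cong (λ l → headerTime l (length r)) (length-map bit z)))
    (reword (begin
        map bit z ++ concatMap (const [ bit false ]) r ++ [ end ]
      ≡⟨ cong (λ w → map bit z ++ w ++ [ end ]) (zeros r) ⟩
        map bit z ++ map bit (replicate (length r) false) ++ [ end ]
      ≡⟨ ++-assoc (map bit z) (map bit (replicate (length r) false)) [ end ] ⟨
        (map bit z ++ map bit (replicate (length r) false)) ++ [ end ]
      ≡⟨ cong (_++ [ end ]) (map-++ bit z (replicate (length r) false)) ⟨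
        row (z ++ replicate (length r) false) ∎)
      (writeAll-appends (map bit z) ⨟ʷ
       overBits-appends (λ b → write-appends (bit false) ⨟ʷ advance-appends) y-end r ⨟ʷ
       write-appends end ⨟ʷ rewind-bits r x-end))
  where
  open ≡-Reasoning
  zeros : ∀ r → concatMap (const [ bit false ]) r ≡ map bit (replicate (length r) false)
  zeros []      = refl
  zeros (_ ∷ r) = cong (bit false ∷_) (zeros r)

-- Each of the `k` readings of the row yields one row of the blow-up; the final
-- `overBits advance ⨟ advance` passes the row and its end marker.
stretchRow : ℕ → Program
stretchRow k =
  repeat k (overBits (repeat k copy ⨟ advance) ⨟ write end ⨟ rewind zero isBit) ⨟
  overBits advance ⨟ advance

stretchRow-appends : ∀ k {x ls cs} r → isBit x ≡ false →
  stretchRow k ⊢ at (x ∷ ls) (bits r ++ just end ∷ cs)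
               ⟿⟨ stretchTime k (length r) ⟩
                 at (just end ∷ (bits r ʳ++ x ∷ ls)) cs
               ⊣ word (replicate k (concatMap (replicate k) r))
stretchRow-appends k r x-end =
  reword (begin
      concat (replicate k (concatMap (λ b → concat (replicate k [ bit b ]) ++ []) r ++ [ end ])) ++
      concatMap (const []) r ++ []
    ≡⟨ cong₂ (λ u v → concat (replicate k (u ++ [ end ])) ++ v ++ []) (stretched r) (erased r) ⟩
      concat (replicate k (row (concatMap (replicate k) r))) ++ []
    ≡⟨ ++-identityʳ _ ⟩
      concat (replicate k (row (concatMap (replicate k) r)))
    ≡⟨ cong concat (map-replicate row k _) ⟨
      word (replicate k (concatMap (replicate k) r)) ∎)
    (repeat-appends k
       (overBits-appends (λ b → repeat-appends k (emit-appends refl) ⨟ʷ advance-appends) refl r ⨟ʷ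
        write-appends end ⨟ʷ rewind-bits r x-end) ⨟ʷ
     overBits-appends (λ b → advance-appends) refl r ⨟ʷ advance-appends)
  where
  open ≡-Reasoning
  erased : ∀ r → concatMap {B = Symbol} (const []) r ≡ []
  erased []      = refl
  erased (_ ∷ r) = erased r
  stretched : ∀ r → concatMap (λ b → concat (replicate k [ bit b ]) ++ []) r ≡ map bit (concatMap (replicate k) r)
  stretched []      = refl
  stretched (b ∷ r) = begin
      (concat (replicate k [ bit b ]) ++ []) ++ concatMap (λ b → concat (replicate k [ bit b ]) ++ []) r
    ≡⟨ cong₂ _++_ (trans (++-identityʳ _) (concat-replicate-[ bit b ] k)) (stretched r) ⟩
      replicate k (bit b) ++ map bit (concatMap (replicate k) r)
    ≡⟨ cong (_++ map bit (concatMap (replicate k) r)) (map-replicate bit k b) ⟨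
      map bit (replicate k b) ++ map bit (concatMap (replicate k) r)
    ≡⟨ map-++ bit (replicate k b) _ ⟨
      map bit (concatMap (replicate k) (b ∷ r)) ∎

-- Adjacency matrices and injectivity of the code

Matrix : ℕ → Set
Matrix n = Fin n → Fin n → Bool

rows : ∀ {n} → Matrix n → List (List Bool)
rows a = tabulate (tabulate ∘ a)

rows-lengths : ∀ {n} (a : Matrix n) → All (λ r → length r ≡ n) (rows a)
rows-lengths a = All.tabulate⁺ (length-tabulate ∘ a)

encode-rows : ∀ G → encode G ≡ word (rows (Graph.adj G))
encode-rows G = cong concat (trans
  (tabulate-cong λ x → cong (_++ [ end ]) (sym (map-tabulate (Graph.adj G x) bit)))
  (sym (map-tabulate (tabulate ∘ Graph.adj G) row)))

length-word : ∀ {n} rs → All (λ r → length r ≡ n) rs → length (word rs) ≡ length rs * suc n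
length-word []       []           = refl
length-word {n} (r ∷ rs) (len ∷ lens) = begin
    length (row r ++ word rs)            ≡⟨ length-++ (row r) ⟩
    length (row r) + length (word rs)    ≡⟨ cong₂ _+_ (length-++ (map bit r)) (length-word rs lens) ⟩
    length (map bit r) + 1 + length rs * suc n ≡⟨ cong (λ l → l + 1 + length rs * suc n) (trans (length-map bit r) len) ⟩
    n + 1 + length rs * suc n            ≡⟨ cong (_+ length rs * suc n) (+-comm n 1) ⟩
    suc n + length rs * suc n            ∎
  where open ≡-Reasoning

length-encode : ∀ G → length (encode G) ≡ Graph.order G * suc (Graph.order G)
length-encode G = trans (cong length (encode-rows G))
  (trans (length-word (rows adj) (rows-lengths adj)) (cong (_* suc order) (length-tabulate (tabulate ∘ adj))))
  where open Graph G

-- The clause for `[]` is a default: in `parse` it is reached only if the last row lacks its end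
-- marker.
pushBit : Bool → List (List Bool) → List (List Bool)
pushBit b []       = [ [ b ] ]
pushBit b (r ∷ rs) = (b ∷ r) ∷ rs

parse : Word → List (List Bool)
parse []          = []
parse (bit b ∷ w) = pushBit b (parse w)
parse (end ∷ w)   = [] ∷ parse w

parse-word : ∀ rs → parse (word rs) ≡ rs
parse-word []       = refl
parse-word (r ∷ rs) = parse-row r
  where
  parse-row : ∀ r → parse (row r ++ word rs) ≡ r ∷ rs
  parse-row []      = cong ([] ∷_) (parse-word rs)
  parse-row (b ∷ r) = cong (pushBit b) (parse-row r)

tabulate-injective : ∀ {A : Set} {n} {f g : Fin n → A} → tabulate f ≡ tabulate g → ∀ i → f i ≡ g i
tabulate-injective eq zero    = ∷-injectiveˡ eq
tabulate-injective eq (suc i) = tabulate-injective (∷-injectiveʳ eq) i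

infix 4 _≋_

-- A code determines the adjacency function only pointwise, which without function extensionality is
-- weaker than equality of graphs. Matching identifies the two orders definitionally.
data _≋_ (G : Graph) : Graph → Set where
  pointwise : ∀ {adj} (symmetric : Symmetric λ x y → T (adj x y)) →
              (∀ x y → Graph.adj G x y ≡ adj x y) →
              G ≋ record { order = Graph.order G ; adj = adj ; symmetric = λ {x} {y} → symmetric {x} {y} }

encode-injective : ∀ {G G′} → encode G ≡ encode G′ → G ≋ G′
encode-injective {G} {G′} eq = same G G′ (begin
    rows (Graph.adj G)                ≡⟨ parse-word _ ⟨
    parse (word (rows (Graph.adj G))) ≡⟨ cong parse (encode-rows G) ⟨
    parse (encode G)                  ≡⟨ cong parse eq ⟩
    parse (encode G′)                 ≡⟨ cong parse (encode-rows G′) ⟩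
    parse (word (rows (Graph.adj G′))) ≡⟨ parse-word _ ⟩
    rows (Graph.adj G′)               ∎)
  where
  open ≡-Reasoning
  same : ∀ G G′ → rows (Graph.adj G) ≡ rows (Graph.adj G′) → G ≋ G′
  same G record { adj = b ; symmetric = b-sym } eq
    -- The number of rows is the order, so the orders are identified before the entries are
    -- compared.
    with refl ← trans (sym (length-tabulate (tabulate ∘ Graph.adj G)))
                      (trans (cong length eq) (length-tabulate (tabulate ∘ b)))
    = pointwise (λ {x} {y} → b-sym {x} {y}) λ x → tabulate-injective (tabulate-injective eq x)

-- From many-one to Turing reductions

eval-mono : ∀ p {m n} → m ≤ n → eval p m ≤ eval p n
eval-mono []      m≤n = z≤n
eval-mono (a ∷ p) m≤n = +-monoʳ-≤ a (*-mono-≤ m≤n (eval-mono p m≤n))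

-- The machine writes the code of `f G` and asks once. `decide` names the verdict inside the proof;
-- the machine obtains it from the oracle.
many-one : ∀ {P Q : Problem} (f : Graph → Graph) (c : Program) (time : ℕ → ℕ) (p : Polynomial) →
  (∀ G → ∃[ t ] c ⊢ at [ nothing ] (map just (word (rows (Graph.adj G)))) ⟿⟨ time (Graph.order G) ⟩
                    t ⊣ word (rows (Graph.adj (f G)))) →
  (∀ G → 2 + (time (Graph.order G) + (Graph.order (f G) * suc (Graph.order (f G)) * 2 + 3)) + 1
         ≡ eval p (Graph.order G)) →
  (∀ {G G′} → G ≋ G′ → Q G → Q G′) →
  (∀ G → P G ⇔ Q (f G)) →
  (∀ G → Dec (P G)) →
  P ≤ᵀ Q
many-one {P} {Q} f c time p computes time≡ respects correct decide =
  queryMachine (transduce c) , p , λ G →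
    let (t , r)          = computes G
        (s , r′ , reads) = transduce-runs {n = time (Graph.order G)} (encode G)
          (subst₂ (λ v w → c ⊢ at [ nothing ] (map just v) ⟿⟨ time (Graph.order G) ⟩ t ⊣ w)
            (sym (encode-rows G)) (sym (encode-rows (f G))) r)
        (m , m≤ , halts) = answer (transduce c) (Language Q) r′
          (subst (λ w → Reflects (Language Q w) (does (decide G))) (sym reads) (oracle G))
    in m , does (decide G) , ≤-trans m≤ (bound G) , halts , proof (decide G)
  where
  oracle : ∀ G → Reflects (Language Q (encode (f G))) (does (decide G))
  oracle G with decide G
  ... | yes PG = ofʸ (f G , refl , Equivalence.to (correct G) PG)
  -- Membership of the code may be witnessed by another graph with the same code.
  ... | no ¬PG = ofⁿ λ (G′ , eq , QG′) →
                   ¬PG (Equivalence.from (correct G) (respects (encode-injective {G′} {f G} eq) QG′))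
  bound : ∀ G → 2 + (time (Graph.order G) + (length (encode (f G)) * 2 + 3)) + 1 ≤ eval p (length (encode G))
  bound G = begin
      2 + (time n + (length (encode (f G)) * 2 + 3)) + 1 ≡⟨ cong (λ l → 2 + (time n + (l * 2 + 3)) + 1) (length-encode (f G)) ⟩
      2 + (time n + (n′ * suc n′ * 2 + 3)) + 1           ≡⟨ time≡ G ⟩
      -- The order is at most the length `n * suc n` of the code.
      eval p n                                           ≤⟨ eval-mono p (m≤m*n n (suc n)) ⟩
      eval p (n * suc n)                                 ≡⟨ cong (eval p) (length-encode G) ⟨
      eval p (length (encode G))                         ∎
    where
    open ≤-Reasoning
    n n′ : ℕ
    n = Graph.order G
    n′ = Graph.order (f G)

-- Matrices of disjoint unions and blow-ups

tabulate-splitAt : ∀ {A : Set} m {n} (f : Fin m → A) (g : Fin n → A) →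
                   tabulate ([ f , g ]′ ∘ splitAt m) ≡ tabulate f ++ tabulate g
tabulate-splitAt zero    f g = refl
tabulate-splitAt (suc m) f g = cong (f zero ∷_)
  (trans (tabulate-cong ([,]-map ∘ splitAt m)) (tabulate-splitAt m (f ∘ suc) g))

tabulate-const : ∀ {A : Set} n (x : A) → tabulate {n = n} (const x) ≡ replicate n x
tabulate-const zero    x = refl
tabulate-const (suc n) x = cong (x ∷_) (tabulate-const n x)

-- The indices form `n` consecutive blocks of length `k`, and `quotient k` is constant on each; the
-- first block is split off.
tabulate-quotient : ∀ {A : Set} n k (f : Fin n → A) →
                    tabulate (f ∘ quotient k) ≡ concatMap (replicate k) (tabulate f)
tabulate-quotient zero    k f = refl
tabulate-quotient (suc n) k f = begin
    tabulate (f ∘ quotient k)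
  ≡⟨ tabulate-cong split ⟩
    tabulate ([ const (f zero) , later ]′ ∘ splitAt k)
  ≡⟨ tabulate-splitAt k (const (f zero)) later ⟩
    tabulate {n = k} (const (f zero)) ++ tabulate later
  ≡⟨ cong₂ _++_ (tabulate-const k (f zero)) (tabulate-quotient n k (f ∘ suc)) ⟩
    replicate k (f zero) ++ concatMap (replicate k) (tabulate (f ∘ suc)) ∎
  where
  open ≡-Reasoning
  later : Fin (n * k) → _
  later = f ∘ suc ∘ quotient {n} k
  split : ∀ i → f (quotient {suc n} k i) ≡ [ const (f zero) , later ]′ (splitAt k i)
  split i with splitAt k i
  ... | inj₁ _ = refl
  ... | inj₂ _ = refl

module _ {m n : ℕ} (a : Matrix m) (b : Matrix n) where

  block : Fin m ⊎ Fin n → Fin m ⊎ Fin n → Bool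
  block (inj₁ u) = [ a u , const false ]′
  block (inj₂ v) = [ const false , b v ]′

  -- The block diagonal matrix of `a` and `b`.
  _⊞_ : Matrix (m + n)
  _⊞_ x y = block (splitAt m x) (splitAt m y)

  rows-⊞ : rows _⊞_ ≡ map (_++ replicate n false) (rows a) ++ map (replicate m false ++_) (rows b)
  rows-⊞ = begin
      rows _⊞_
    ≡⟨ tabulate-cong (block-row ∘ splitAt m) ⟩
      tabulate ([ padʳ ∘ tabulate ∘ a , padˡ ∘ tabulate ∘ b ]′ ∘ splitAt m)
    ≡⟨ tabulate-splitAt m (padʳ ∘ tabulate ∘ a) (padˡ ∘ tabulate ∘ b) ⟩
      tabulate (padʳ ∘ tabulate ∘ a) ++ tabulate (padˡ ∘ tabulate ∘ b)
    ≡⟨ cong₂ _++_ (map-tabulate (tabulate ∘ a) padʳ) (map-tabulate (tabulate ∘ b) padˡ) ⟨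
      map padʳ (rows a) ++ map padˡ (rows b) ∎
    where
    open ≡-Reasoning
    padʳ padˡ : List Bool → List Bool
    padʳ = _++ replicate n false
    padˡ = replicate m false ++_
    block-row : ∀ s → tabulate (block s ∘ splitAt m) ≡ [ padʳ ∘ tabulate ∘ a , padˡ ∘ tabulate ∘ b ]′ s
    block-row (inj₁ u) = trans (tabulate-splitAt m (a u) (const false)) (cong (tabulate (a u) ++_) (tabulate-const n false))
    block-row (inj₂ v) = trans (tabulate-splitAt m (const false) (b v)) (cong (_++ tabulate (b v)) (tabulate-const m false))

_⊕_ : Graph → Graph → Graph
H ⊕ G = record { order = H.order + G.order ; adj = adj ; symmetric = λ {x} {y} → symmetric x y }
  where
  module H = Graph H
  module G = Graph G
  adj : Matrix (H.order + G.order)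
  adj = H.adj ⊞ G.adj
  symmetric : ∀ x y → T (adj x y) → T (adj y x)
  symmetric x y with splitAt H.order x | splitAt H.order y
  ... | inj₁ _ | inj₁ _ = H.symmetric
  ... | inj₁ _ | inj₂ _ = id
  ... | inj₂ _ | inj₁ _ = id
  ... | inj₂ _ | inj₂ _ = G.symmetric

-- The twins of `x` are the vertices `combine x i`; they are adjacent to one another exactly when
-- `x` has a loop.
blowUp : ℕ → Graph → Graph
blowUp k G = record
  { order     = order * k
  ; adj       = λ p q → adj (quotient k p) (quotient k q)
  ; symmetric = symmetric
  }
  where open Graph G

rows-blowUp : ∀ k G → rows (Graph.adj (blowUp k G)) ≡
              concatMap (λ r → replicate k (concatMap (replicate k) r)) (rows (Graph.adj G))
rows-blowUp k G = begin
    rows (Graph.adj (blowUp k G))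
  ≡⟨ tabulate-cong {n = order * k} (λ p → tabulate-quotient order k (adj (quotient k p))) ⟩
    tabulate {n = order * k} (concatMap (replicate k) ∘ tabulate ∘ adj ∘ quotient k)
  ≡⟨ tabulate-quotient order k (concatMap (replicate k) ∘ tabulate ∘ adj) ⟩
    concatMap (replicate k) (tabulate (concatMap (replicate k) ∘ tabulate ∘ adj))
  ≡⟨ cong (concatMap (replicate k)) (map-tabulate (tabulate ∘ adj) (concatMap (replicate k))) ⟨
    concatMap (replicate k) (map (concatMap (replicate k)) (rows adj))
  ≡⟨ concatMap-map (replicate k) (concatMap (replicate k)) (rows adj) ⟩
    concatMap (λ r → replicate k (concatMap (replicate k) r)) (rows adj) ∎
  where
  open Graph G
  open ≡-Reasoning

-- Programs for the two reductions

-- The input always starts with n bits followed by another cell, also when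
-- n = 0 and the input is blank.
first-row : ∀ {n} (a : Matrix n) →
  ∃[ r ] ∃[ x ] ∃[ cs ] length r ≡ n × isBit x ≡ false ×
    at [ nothing ] (map just (word (rows a))) ≡ at [ nothing ] (bits r ++ x ∷ cs)
first-row {zero}  a = [] , nothing , [] , refl , refl , refl
first-row {suc n} a = tabulate (a zero) , just end , _ , length-tabulate (a zero) , refl ,
                      cong (at [ nothing ]) (cells-row (tabulate (a zero)) _)

module _ (H : Graph) where
  open Graph H using () renaming (order to h; adj to adjH)

  -- Writing the rows of `H` leaves the input head at its starting position, from which the loop
  -- over the rows of `G` takes over.
  sumProgram : Program
  sumProgram = each (allFin h) (padRight ∘ tabulate ∘ adjH) ⨟ overRows (padLeft (replicate h false))

  sumProgram-appends : ∀ {n} (a : Matrix n) → ∃[ t ]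
    sumProgram ⊢ at [ nothing ] (map just (word (rows a)))
      ⟿⟨ (h * headerTime h n + 1) + (n * suc (padTime h n) + 1) ⟩ t ⊣ word (rows (adjH ⊞ a))
  sumProgram-appends a with first-row a
  sumProgram-appends {n} a | r , x , cs , refl , x-end , start≡ =
    t , reword output
      (retime (≤-reflexive (cong₂ (λ l l′ → (l * headerTime h n + 1) + (l′ * suc (padTime h n) + 1))
                 (length-tabulate {n = h} id) (length-tabulate (tabulate ∘ a))))
        (each-appends (allFin h) upper ⨟ʷ lower))
    where
    upper : ∀ u → padRight (tabulate (adjH u)) ⊢ at [ nothing ] (map just (word (rows a)))
            ⟿⟨ headerTime h n ⟩
              at [ nothing ] (map just (word (rows a))) ⊣ row (tabulate (adjH u) ++ replicate n false)
    upper u =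
      -- `start≡` displays `n` bits and a non-bit at the start of the input, as `padRight-appends`
      -- requires.
      subst (λ t → padRight (tabulate (adjH u)) ⊢ t ⟿⟨ _ ⟩ t ⊣ _) (sym start≡)
        (retime (≤-reflexive (cong (λ l → headerTime l n) (length-tabulate (adjH u))))
          (padRight-appends (tabulate (adjH u)) r refl x-end))
    pad : ∀ {y ls cs} r′ → length r′ ≡ n → isBit y ≡ false →
          padLeft (replicate h false) ⊢ at (y ∷ ls) (bits r′ ++ just end ∷ cs)
            ⟿⟨ padTime h n ⟩
              at (just end ∷ (bits r′ ʳ++ y ∷ ls)) cs ⊣ row (replicate h false ++ r′)
    pad r′ len y-end =
      retime (≤-reflexive (cong₂ padTime (length-replicate h) len))
        (padLeft-appends (replicate h false) r′ y-end)
    rest = overRows-appends pad (rows a) (rows-lengths a) refl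
    t = proj₁ rest
    lower = proj₂ rest
    output : concatMap (λ u → row (tabulate (adjH u) ++ replicate n false)) (allFin h) ++
             concatMap (λ r → row (replicate h false ++ r)) (rows a) ≡ word (rows (adjH ⊞ a))
    output = begin
        concatMap (λ u → row (tabulate (adjH u) ++ replicate n false)) (allFin h) ++
        concatMap (λ r → row (replicate h false ++ r)) (rows a)
      ≡⟨ cong₂ _++_ (concatMap-map row (λ u → tabulate (adjH u) ++ replicate n false) (allFin h))
                    (concatMap-map row (replicate h false ++_) (rows a)) ⟨
        word (map (λ u → tabulate (adjH u) ++ replicate n false) (allFin h)) ++
        word (map (replicate h false ++_) (rows a))
      ≡⟨ cong (λ rs → word rs ++ word (map (replicate h false ++_) (rows a)))
           (trans (map-tabulate id (λ u → tabulate (adjH u) ++ replicate n false))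
                  (sym (map-tabulate (tabulate ∘ adjH) (_++ replicate n false)))) ⟩
        word (map (_++ replicate n false) (rows adjH)) ++ word (map (replicate h false ++_) (rows a))
      ≡⟨ concatMap-++ row (map (_++ replicate n false) (rows adjH)) _ ⟨
        word (map (_++ replicate n false) (rows adjH) ++ map (replicate h false ++_) (rows a))
      ≡⟨ cong word (rows-⊞ adjH a) ⟨
        word (rows (adjH ⊞ a)) ∎
      where open ≡-Reasoning

word-concatMap : ∀ {A : Set} (f : A → List (List Bool)) xs → word (concatMap f xs) ≡ concatMap (word ∘ f) xs
word-concatMap f []       = refl
word-concatMap f (x ∷ xs) = trans (concatMap-++ row (f x) _) (cong (word (f x) ++_) (word-concatMap f xs))

stretchProgram : ℕ → Program
stretchProgram k = overRows (stretchRow k)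

stretchProgram-appends : ∀ k G → let n = Graph.order G in ∃[ t ]
  stretchProgram k ⊢ at [ nothing ] (map just (word (rows (Graph.adj G))))
    ⟿⟨ n * suc (stretchTime k n) + 1 ⟩
      t ⊣ word (rows (Graph.adj (blowUp k G)))
stretchProgram-appends k G =
  let (t , r) = overRows-appends (λ { r refl x-end → stretchRow-appends k r x-end })
                  (rows adj) (rows-lengths adj) refl
  in t , reword output (retime (≤-reflexive (cong (λ l → l * suc (stretchTime k order) + 1) (length-tabulate (tabulate ∘ adj)))) r)
  where
  open Graph G
  output : concatMap (λ r → word (replicate k (concatMap (replicate k) r))) (rows adj) ≡
           word (rows (Graph.adj (blowUp k G)))
  output = trans (sym (word-concatMap (λ r → replicate k (concatMap (replicate k) r)) (rows adj))) (cong word (sym (rows-blowUp k G)))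

-- Decidability and invariance under `_≋_`

-- Functions are enumerated through their codes in `Fin (n ^ m)`. Decoding returns a function only
-- up to pointwise equality, hence `respects`.
∃-function? : ∀ {m n} {P : (Fin m → Fin n) → Set} →
              (∀ {f g} → (∀ x → f x ≡ g x) → P f → P g) →
              (∀ f → Dec (P f)) → Dec (∃ P)
∃-function? respects P? =
  map′ (λ (i , p) → finToFun i , p)
       (λ (f , p) → funToFin f , respects (sym ∘ finToFun-funToFin f) p)
       (any? (P? ∘ finToFun))

module _ (H : Graph) where
  open Graph H using () renaming (order to h; adj to adjH)

  Hom? : ∀ G → Dec (Hom H G)
  Hom? G = ∃-function?
    (λ eq hom {x} {y} xy → subst₂ (E H) (eq x) (eq y) (hom xy))
    (λ f → map′ (λ hom {x} {y} → hom x y) (λ hom x y → hom {x} {y})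
             (all? λ x → all? λ y → T? (Graph.adj G x y) →-dec T? (adjH (f x) (f y))))

  SurHom? : ∀ G → Dec (SurHom H G)
  SurHom? G = ∃-function?
    (λ eq (hom , onto , edges) →
      (λ {x} {y} xy → subst₂ (E H) (eq x) (eq y) (hom xy)) ,
      (λ u → let (x , xu) = onto u in x , trans (sym (eq x)) xu) ,
      (λ uv → let (x , y , xy , xu , yv) = edges uv
              in x , y , xy , trans (sym (eq x)) xu , trans (sym (eq y)) yv))
    (λ f →
      map′ (λ hom {x} {y} → hom x y) (λ hom x y → hom {x} {y})
        (all? λ x → all? λ y → T? (Graph.adj G x y) →-dec T? (adjH (f x) (f y))) ×-dec
      (all? λ u → any? λ x → f x ≟ u) ×-dec
      map′ (λ edges {u} {v} → edges u v) (λ edges u v → edges {u} {v})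
        (all? λ u → all? λ v → T? (adjH u v) →-dec
          (any? λ x → any? λ y → T? (Graph.adj G x y) ×-dec f x ≟ u ×-dec f y ≟ v)))

  FulRel-respects : ∀ {G G′} → G ≋ G′ → FulRel H G → FulRel H G′
  FulRel-respects {G} {G′} (pointwise _ eq) (R , (image , edges) , domain) =
    R , (image , λ u v → mk⇔
      (λ uv → let (x , y , xy , xu , yv) = toWitness {a? = imageEdge? G′ R u v} uv
              in Equivalence.to (edges u v)
                   (fromWitness {a? = imageEdge? G R u v} (x , y , subst T (sym (eq x y)) xy , xu , yv)))
      (λ uv → let (x , y , xy , xu , yv) = toWitness {a? = imageEdge? G R u v} (Equivalence.from (edges u v) uv)
              in fromWitness {a? = imageEdge? G′ R u v} (x , y , subst T (eq x y) xy , xu , yv))) , domain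

  SurHom-respects : ∀ {G G′} → G ≋ G′ → SurHom H G → SurHom H G′
  SurHom-respects (pointwise _ eq) (f , hom , onto , edges) =
    f , (λ {x} {y} xy → hom (subst T (sym (eq x y)) xy)) , onto ,
    λ uv → let (x , y , xy , xu , yv) = edges uv in x , y , subst T (eq x y) xy , xu , yv

  -- Correctness of the reductions

  -- The relation is the graph of `f`: image edges are edges of `H` because `f` is a homomorphism,
  -- and surjectivity on edges gives the converse.
  SurHom⇒FulRel : ∀ G → SurHom H G → FulRel H G
  SurHom⇒FulRel G (f , hom , onto , edges) =
    R , ((λ u → let (x , xu) = onto u in x , fromWitness xu) , λ u v → mk⇔
      (λ uv → let (x , y , xy , xu , yv) = toWitness {a? = imageEdge? G R u v} uv
              in subst₂ (E H) (toWitness xu) (toWitness yv) (hom xy))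
      (λ uv → let (x , y , xy , xu , yv) = edges uv
              in fromWitness {a? = imageEdge? G R u v} (x , y , xy , fromWitness xu , fromWitness yv))) ,
    λ x → f x , fromWitness refl
    where
    R : Relation (V G) (V H)
    R x u = ⌊ f x ≟ u ⌋

  -- The identity on the summand `H` makes every extension of it surjective on vertices and edges,
  -- whatever `f` does on `G`.
  Hom⇔FulRel-⊕ : ∀ G → Hom H G ⇔ FulRel H (H ⊕ G)
  Hom⇔FulRel-⊕ G = mk⇔ to from
    where
    open Graph G using () renaming (order to n; adj to adjG)
    to : Hom H G → FulRel H (H ⊕ G)
    to (f , hom) = SurHom⇒FulRel (H ⊕ G) (fold ∘ splitAt h , (λ {x} {y} → fold-hom x y) ,
      (λ u → u ↑ˡ n , cong fold (splitAt-↑ˡ h u n)) ,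
      λ {u} {v} uv → u ↑ˡ n , v ↑ˡ n ,
        subst₂ (λ s s′ → T (block adjH adjG s s′)) (sym (splitAt-↑ˡ h u n)) (sym (splitAt-↑ˡ h v n)) uv ,
        cong fold (splitAt-↑ˡ h u n) , cong fold (splitAt-↑ˡ h v n))
      where
      fold : V H ⊎ V G → V H
      fold = [ id , f ]′
      fold-hom : ∀ x y → E (H ⊕ G) x y → E H (fold (splitAt h x)) (fold (splitAt h y))
      fold-hom x y with splitAt h x | splitAt h y
      ... | inj₁ _ | inj₁ _ = id
      ... | inj₂ _ | inj₂ _ = hom
      ... | inj₁ _ | inj₂ _ = λ ()
      ... | inj₂ _ | inj₁ _ = λ ()
    from : FulRel H (H ⊕ G) → Hom H G
    -- Vertices related to adjacent vertices form an image edge, hence an edge of `H`; so every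
    -- choice works.
    from (R , (image , edges) , domain) = (λ x → proj₁ (domain (h ↑ʳ x))) , λ {x} {y} xy →
      Equivalence.to (edges _ _) (fromWitness {a? = imageEdge? (H ⊕ G) R _ _}
        (h ↑ʳ x , h ↑ʳ y ,
         subst₂ (λ s s′ → T (block adjH adjG s s′)) (sym (splitAt-↑ʳ h n x)) (sym (splitAt-↑ʳ h n y)) xy ,
         proj₂ (domain (h ↑ʳ x)) , proj₂ (domain (h ↑ʳ y))))

  -- With |H| copies the blow-up would lose all of G when H is empty.
  FulRel⇔SurHom-blowUp : ∀ G → FulRel H G ⇔ SurHom H (blowUp (suc h) G)
  FulRel⇔SurHom-blowUp G = mk⇔ to from
    where
    open Graph G using () renaming (order to n; adj to adjG)
    vertex : V (blowUp (suc h) G) → V G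
    vertex = quotient (suc h)
    label : V (blowUp (suc h) G) → Fin (suc h)
    label = remainder {n} (suc h)
    vertex-combine : ∀ x i → vertex (combine x i) ≡ x
    vertex-combine x i = cong proj₁ (remQuot-combine x i)
    lift-edge : ∀ {x y} i j → E G x y → E (blowUp (suc h) G) (combine x i) (combine y j)
    lift-edge {x} {y} i j = subst₂ (E G) (sym (vertex-combine x i)) (sym (vertex-combine y j))

    to : FulRel H G → SurHom H (blowUp (suc h) G)
    to (R , (image , edges) , domain) = f ,
      (λ {p} {q} pq → Equivalence.to (edges _ _)
        (fromWitness {a? = imageEdge? G R _ _} (_ , _ , pq , choose-related _ (label p) , choose-related _ (label q)))) ,
      (λ u → let (x , xu) = image u in combine x (suc u) , f-combine xu) ,
      λ {u} {v} uv →
        let (x , y , xy , xu , yv) = toWitness {a? = imageEdge? G R u v} (Equivalence.from (edges u v) uv)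
        in combine x (suc u) , combine y (suc v) , lift-edge (suc u) (suc v) xy , f-combine xu , f-combine yv
      where
      -- The twin labelled `suc u` goes to `u` if `u` is related to `x`. All other twins go to the
      -- default vertex given by full domain.
      choose : V G → Fin (suc h) → V H
      choose x zero    = proj₁ (domain x)
      choose x (suc u) = if R x u then u else proj₁ (domain x)
      choose-related : ∀ x i → T (R x (choose x i))
      choose-related x zero = proj₂ (domain x)
      choose-related x (suc u) with R x u in eq
      ... | true  = subst T (sym eq) tt
      ... | false = proj₂ (domain x)
      f : V (blowUp (suc h) G) → V H
      f p = choose (vertex p) (label p)
      f-combine : ∀ {x u} → T (R x u) → f (combine x (suc u)) ≡ u
      f-combine {x} {u} xu = trans (cong (λ (x , i) → choose x i) (remQuot-combine x (suc u))) (chosen xu)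
        where
        chosen : T (R x u) → choose x (suc u) ≡ u
        chosen with R x u
        ... | true  = λ _ → refl
        ... | false = λ ()

    from : SurHom H (blowUp (suc h) G) → FulRel H G
    from (f , hom , onto , edges) = R ,
      ((λ u → let (p , pu) = onto u in vertex p , related pu) , λ u v → mk⇔
        (λ uv → let (x , y , xy , xu , yv) = toWitness {a? = imageEdge? G R u v} uv
                    (i , iu) = toWitness {a? = related? x u} xu
                    (j , jv) = toWitness {a? = related? y v} yv
                -- All twins of `x` are adjacent to all twins of `y`, so the labels `i` and `j` can
                -- be chosen independently.
                in subst₂ (E H) iu jv (hom (lift-edge i j xy)))
        (λ uv → let (p , q , pq , pu , qv) = edges uv
                in fromWitness {a? = imageEdge? G R u v} (vertex p , vertex q , pq , related pu , related qv))) ,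
      -- The label `zero` exists even when `H` is empty.
      λ x → f (combine x zero) , fromWitness {a? = related? x _} (zero , refl)
      where
      related? : ∀ x u → Dec (∃[ i ] f (combine x i) ≡ u)
      related? x u = any? λ i → f (combine x i) ≟ u
      R : Relation (V G) (V H)
      R x u = ⌊ related? x u ⌋
      related : ∀ {p u} → f p ≡ u → T (R (vertex p) u)
      related {p} {u} pu = fromWitness {a? = related? (vertex p) u}
        (label p , trans (cong f (combine-remQuot {n} (suc h) p)) pu)

  -- Passing to the blow-up leaves only functions, not relations, to be searched.
  FulRel? : ∀ G → Dec (FulRel H G)
  FulRel? G = map′ (Equivalence.from (FulRel⇔SurHom-blowUp G)) (Equivalence.to (FulRel⇔SurHom-blowUp G))
                   (SurHom? (blowUp (suc h) G))

-- The two reductions with explicit polynomial bounds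

theorem6p1 : (H : Graph) → (Hom H ≤ᵀ FulRel H) × (FulRel H ≤ᵀ SurHom H)
theorem6p1 H =
  many-one (H ⊕_) (sumProgram H)
    (λ n → (h * headerTime h n + 1) + (n * suc (padTime h n) + 1))
    -- The total time expanded in powers of the order of `G`, with `h` a constant; `sum-time`
    -- verifies the expansion.
    (3 * h * h + 8 * h + 8 ∷ 10 * h + 7 ∷ 5 ∷ [])
    (λ G → sumProgram-appends H (Graph.adj G)) (λ G → sum-time h (Graph.order G))
    (FulRel-respects H) (Hom⇔FulRel-⊕ H) (Hom? H) ,
  many-one (blowUp k) (stretchProgram k)
    (λ n → n * suc (stretchTime k n) + 1)
    (7 ∷ 7 * k + 4 ∷ 3 * k * k + 5 * k + 2 ∷ [])
    (stretchProgram-appends k) (λ G → stretch-time k (Graph.order G))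
    (SurHom-respects H) (FulRel⇔SurHom-blowUp H) (FulRel? H)
  where
  h k : ℕ
  h = Graph.order H
  k = suc h
  -- The time functions and `eval` are unfolded by hand, so that the ring solver is given plain
  -- polynomial expressions.
  sum-time : ∀ h n →
    2 + ((h * ((h * 1 + 1) + ((n * 3 + 1) + (1 + (n * 2 + 3)))) + 1) + (n * suc ((h * 1 + 1) + ((n * 3 + 1) + 2)) + 1)
         + ((h + n) * suc (h + n) * 2 + 3)) + 1
    ≡ 3 * h * h + 8 * h + 8 + n * (10 * h + 7 + n * (5 + n * 0))
  sum-time = solve-∀
  stretch-time : ∀ k n →
    2 + (n * suc ((k * ((n * suc (k * 1 + 1 + 1) + 1) + (1 + (n * 2 + 3))) + 1) + ((n * 2 + 1) + 1)) + 1
         + (n * k * suc (n * k) * 2 + 3)) + 1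
    ≡ 7 + n * (7 * k + 4 + n * (3 * k * k + 5 * k + 2 + n * 0))
  stretch-time = solve-∀
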